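{- Let $\zeta(n) = \max\{ \mathsf{zn}(S[i..]) / \mathsf{zn}(S) \mid S \in \Sigma^n,\ 1 < i \leq n\}$ for $n\ge 2$. Then $\zeta(n) = O(\log n)$.
   Context: $\Sigma$ is an alphabet. Strings are indexed from $1$; $S[i..j]$ is the substring from position $i$ to $j$ (empty if $j<i$), and $S[i..]=S[i..|S|]$. $\mathsf{lcp}(X,Y)$ is the length of the longest common prefix of $X$ and $Y$. Non self-referencing LZ77 factorization: $\mathsf{LZN}(S)$ is the factorization $S=f_1\cdots f_{z}$ defined greedily from left to right as follows. Let $u_i=|f_1\cdots f_{i-1}|+1$ and let $p_i=\max_{1\le j<u_i}\mathsf{lcp}(S[u_i..],S[j..u_i-1])$ (with $p_i=0$ if $i=1$). Then $f_i=S[u_i..\min\{u_i+p_i,|S|\}]$. That is, $f_i$ is a fresh letter or the shortest prefix of $S[u_i..]$ with no occurrence inside $S[1..u_i-1]$ (or all of $S[u_i..]$ if that occurs in $S[1..u_i-1]$). The size $\mathsf{zn}(S)$ is the number $z$ of factors. The constant hidden in $O(\cdot)$ is absolute (independent of $\Sigma$). -}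

module Defs where

open import Data.Bool using (if_then_else_)
open import Data.Integer using (+_)
open import Data.List using (List; []; _∷_; length; map; take; drop; upTo)
open import Data.List.Extrema.Nat using (max)
open import Data.Nat using (ℕ; zero; suc; _+_; _∸_; _⊓_; _≤_; _<_; _≤ᵇ_; NonZero)
open import Data.Nat.Properties using (<⇒≤; ≤-trans)
open import Data.Product using (Σ; _×_)
open import Data.Rational as ℚ using (ℚ)
open import Relation.Binary.Definitions using (DecidableEquality)
open import Relation.Binary.PropositionalEquality using (_≡_; subst; sym)
open import Relation.Nullary using (does)

-- Positions are 1-based, as in the usual notation S[i..j]; only i ≥ 1 is meaningful.

infix 30 _[_⋯_] _[_⋯]

_[_⋯_] : ∀ {A : Set} → List A → ℕ → ℕ → List A
S [ i ⋯ j ] = take (suc j ∸ i) (drop (i ∸ 1) S)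

_[_⋯] : ∀ {A : Set} → List A → ℕ → List A
S [ i ⋯] = S [ i ⋯ length S ]

module LZ {A : Set} (_≟_ : DecidableEquality A) where

  lcp : List A → List A → ℕ
  lcp []       _        = 0
  lcp (_ ∷ _)  []       = 0
  lcp (x ∷ xs) (y ∷ ys) = if does (x ≟ y) then suc (lcp xs ys) else 0

  -- The maximum over 1 ≤ j < u, read as 0 when u = 1.
  p : List A → ℕ → ℕ
  p S u = max 0 (map (λ j → lcp (S [ u ⋯]) (S [ j ⋯ u ∸ 1 ])) (map suc (upTo (u ∸ 1))))

  -- The factors starting at position u and later. The first argument is fuel for
  -- termination: each factor is nonempty, so length S is enough from position 1.
  factorsFrom : ℕ → List A → ℕ → List (List A)
  factorsFrom zero    S u = []
  factorsFrom (suc k) S u =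
    if u ≤ᵇ length S
    then S [ u ⋯ (u + p S u) ⊓ length S ] ∷ factorsFrom k S (suc (u + p S u))
    else []

  LZN : List A → List (List A)
  LZN S = factorsFrom (length S) S 1

  zn : List A → ℕ
  zn S = length (LZN S)

  zn-nonZero : ∀ S → 1 ≤ length S → NonZero (zn S)
  zn-nonZero (_ ∷ _) _ = _

  ratio : (S : List A) (i : ℕ) → 1 ≤ length S → ℚ
  ratio S i 1≤∣S∣ = ℚ._/_ (+ zn (S [ i ⋯])) (zn S) {{zn-nonZero S 1≤∣S∣}}

  Ratios : ℕ → ℚ → Set
  Ratios n r =
    Σ (List A) λ S → Σ (length S ≡ n) λ ∣S∣≡n →
    Σ ℕ λ i → Σ (1 < i) λ 1<i → Σ (i ≤ n) λ i≤n →
    r ≡ ratio S i (subst (1 ≤_) (sym ∣S∣≡n) (≤-trans (<⇒≤ 1<i) i≤n))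

IsMaximum : (ℚ → Set) → ℚ → Set
IsMaximum P m = P m × (∀ r → P r → r ℚ.≤ m)

-- ζ is the function n ↦ max { zn(S[i..]) / zn(S) ∣ S ∈ Aⁿ, 1 < i ≤ n } on n ≥ 2;
-- its values at 0 and 1 are unconstrained.
IsZeta : {A : Set} → DecidableEquality A → (ℕ → ℚ) → Set
IsZeta _≟_ ζ = ∀ n → 2 ≤ n → IsMaximum (LZ.Ratios _≟_ n) (ζ n)

{-# OPTIONS --safe #-}
module Submission where

-- Compare the factorizations of S and of its suffix T one dyadic length scale at a time.
-- A factor of T of length ℓ at position b has no occurrence inside T[..b), so a window of
-- T containing [b - ℓ, b + ℓ) cannot occur earlier in T. With D ≤ ℓ < 2D, this gives D
-- such windows of length 5D, starting at positions that no other factor uses (unless the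
-- factor is among the first five of its scale and too close to the start of T). In S,
-- every window has a copy containing the last position of a factor, so S has at most
-- 5D zn(S) distinct windows of length 5D. Hence T has O(zn(S)) factors of each scale, and
-- there are O(log n) scales.

open import Defs
open import Data.Bool using (true; false; T)
open import Data.Bool.Properties using (T-≡)
open import Data.Empty using (⊥-elim)
open import Data.Fin as Fin using (Fin; toℕ; fromℕ<; combine; remQuot)
import Data.Fin.Properties as Fin
open import Data.Integer as ℤ using (+_; +≤+)
import Data.Integer.Properties as ℤ
open import Data.List using (List; []; _∷_; length; map; take; drop; filter; lookup)
import Data.List.Extrema.Nat as Extrema
open import Data.List.Membership.Propositional.Properties using (∈-lookup; ∈-map⁺; ∈-upTo⁺)
open import Data.List.Properties using (take-all; length-drop; length-take)
open import Data.List.Relation.Unary.All as All using (All; []; _∷_)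
import Data.List.Relation.Unary.All.Properties as All
open import Data.List.Relation.Unary.AllPairs using (AllPairs; []; _∷_)
import Data.List.Relation.Unary.AllPairs.Properties as AllPairs
open import Data.List.Relation.Unary.Any as Any using (Any; here; there)
open import Data.Maybe using (Maybe; just; nothing)
open import Data.Maybe.Properties using (just-injective)
open import Data.Nat
open import Data.Nat.Induction using (<-wellFounded)
open import Data.Nat.Logarithm using (⌊log₂_⌋; ⌊log₂⌋-mono-≤; ⌊log₂[2^n]⌋≡n)
open import Data.Nat.Properties
open import Data.Nat.Tactic.RingSolver using (solve-∀)
open import Data.Product using (_×_; _,_; proj₁; proj₂; ∃-syntax; uncurry)
open import Data.Rational as ℚ using (ℚ)
import Data.Rational.Properties as ℚ
open import Data.Rational.Unnormalised as ℚᵘ using (mkℚᵘ; *≤*)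
import Data.Rational.Unnormalised.Properties as ℚᵘ
open import Data.Unit using (tt)
open import Function using (_∘_; id; Equivalence)
open import Level using (0ℓ)
open import Induction.WellFounded using (Acc; acc)
open import Relation.Binary.Definitions using (DecidableEquality; tri<; tri≈; tri>)
open import Relation.Binary.PropositionalEquality
open import Relation.Nullary using (¬_; yes; no; contradiction)
open import Relation.Nullary.Decidable using (¬?)
open import Relation.Unary using (Pred; Decidable)

-- Lists, dyadic counting, and logarithmic and rational arithmetic.

private variable
  X B : Set

AllPairs-lookup : ∀ {R : X → X → Set} {xs} → AllPairs R xs →
                  ∀ {i j} → i Fin.< j → R (lookup xs i) (lookup xs j)
AllPairs-lookup (r ∷ _)  {Fin.zero}  {Fin.suc j} _         = All.lookup r (∈-lookup j)
AllPairs-lookup (_ ∷ rs) {Fin.suc i} {Fin.suc j} (s≤s i<j) = AllPairs-lookup rs i<j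

length-filter-split : ∀ {P : Pred X 0ℓ} (P? : Decidable P) xs →
  length xs ≡ length (filter P? xs) + length (filter (¬? ∘ P?) xs)
length-filter-split P? [] = refl
length-filter-split P? (x ∷ xs) with P? x
... | yes _ = cong suc (length-filter-split P? xs)
... | no  _ = trans (cong suc (length-filter-split P? xs)) (sym (+-suc _ _))

-- Peels off the top dyadic class and recurses on the rest. `R` and `G` stand for a pairwise and a
-- pointwise property, since these are inherited by filtered sublists. No element satisfies the
-- bound for `K = 0`.
dyadic-count : ∀ (h : X → ℕ) {R : X → X → Set} {G : X → Set} {c} →
  (∀ k xs → AllPairs R xs → All G xs →
     All (λ x → 2 ^ k ≤ suc (h x) × suc (h x) < 2 ^ suc k) xs → length xs ≤ c) →
  ∀ K xs → AllPairs R xs → All G xs → All (λ x → suc (h x) < 2 ^ K) xs → length xs ≤ K * c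
dyadic-count h bound zero    []      _  _  _               = z≤n
dyadic-count h bound zero    (_ ∷ _) _  _  (s≤s () ∷ _)
dyadic-count h {c = c} bound (suc K) xs rs gs hs = begin
  length xs                                                 ≡⟨ length-filter-split big? xs ⟩
  length (filter big? xs) + length (filter (¬? ∘ big?) xs)  ≤⟨ +-mono-≤ bigs smalls ⟩
  c + K * c                                                 ∎
  where
  open ≤-Reasoning
  big? = λ x → 2 ^ K ≤? suc (h x)
  bigs = bound K (filter big? xs) (AllPairs.filter⁺ big? rs) (All.filter⁺ big? gs)
    (All.zip (All.all-filter big? xs , All.filter⁺ big? hs))
  smalls = dyadic-count h bound K (filter (¬? ∘ big?) xs)
    (AllPairs.filter⁺ (¬? ∘ big?) rs) (All.filter⁺ (¬? ∘ big?) gs)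
    (All.map ≰⇒> (All.all-filter (¬? ∘ big?) xs))

n<2^[1+⌊log₂n⌋] : ∀ n → n < 2 ^ suc ⌊log₂ n ⌋
n<2^[1+⌊log₂n⌋] n = ≰⇒> λ 2^≤n → <-irrefl refl
  (subst (_≤ ⌊log₂ n ⌋) (⌊log₂[2^n]⌋≡n (suc ⌊log₂ n ⌋)) (⌊log₂⌋-mono-≤ 2^≤n))

-- `ℚ._/_` reduces to lowest terms, so the comparison is made on unnormalised fractions, where it is
-- cross-multiplication.
/-≤ : ∀ m c d .{{_ : NonZero d}} → m ≤ c * d → (+ m) ℚ./ d ℚ.≤ (+ c) ℚ./ 1
/-≤ m c (suc d) m≤cd = ℚ.toℚᵘ-cancel-≤
  (ℚᵘ.≤-respˡ-≃ (ℚᵘ.≃-sym (ℚ.toℚᵘ-fromℚᵘ (mkℚᵘ (+ m) d)))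
  (ℚᵘ.≤-respʳ-≃ (ℚᵘ.≃-sym (ℚ.toℚᵘ-fromℚᵘ (mkℚᵘ (+ c) 0)))
  (*≤* (subst₂ ℤ._≤_ (sym (ℤ.*-identityʳ (+ m))) (ℤ.pos-* c (suc d)) (+≤+ m≤cd)))))

-- Copied and new factors, and windows in a word.

-- Words are functions on ℕ with 0-based positions. A factor (b , p) occupies the
-- positions b, …, b + p, so it has length suc p. The last factor may include the
-- position just past the end of the word, where S ! i is nothing; this makes it new too.

Agree : (ℕ → B) → ℕ → ℕ → ℕ → Set
Agree w a c m = ∀ {x} → x < m → w (a + x) ≡ w (c + x)

Copied New : (ℕ → B) → ℕ × ℕ → Set
Copied w (b , p) = ∃[ q ] q + p ≤ b × Agree w q b p
New    w (b , p) = ∀ q → q + suc p ≤ b → ¬ Agree w q b (suc p)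

Fresh : (ℕ → B) → ℕ → ℕ → Set
Fresh w L s = ∀ {s′} → s′ < s → ¬ Agree w s′ s L

Precedes : ℕ × ℕ → ℕ × ℕ → Set
Precedes (b , p) (b′ , _) = suc (b + p) ≤ b′

Covers : ℕ → ℕ × ℕ → Set
Covers g (b , p) = b ≤ g × g ≤ b + p

-- An earlier occurrence of the window at distance δ shifts the factor left by δ,
-- repeatedly while it stays in the window; the last shift lands it before position b
-- without overlap.
new⇒fresh : ∀ {w : ℕ → B} {b p s L} → New w (b , p) →
            s + suc p ≤ b → b + p < s + L → Fresh w L s
new⇒fresh {w = w} {b} {p} {s} {L} new s+p<b b+p<s+L {s′} s′<s agree
  with r , refl ← m≤n⇒∃[o]m+o≡n (m+n≤o⇒m≤o s s+p<b) =
  descend r (<-wellFounded r) ≤-refl (λ _ → refl)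
  where
  shift : ∀ {t} → t ≤ r → Agree w (s + t) (s + r) (suc p) → Agree w (s′ + t) (s + r) (suc p)
  shift {t} t≤r eq {x} x≤p = begin
    w (s′ + t + x)    ≡⟨ cong w (+-assoc s′ t x) ⟩
    w (s′ + (t + x))  ≡⟨ agree (+-cancelˡ-< s _ _ s+[t+x]<s+L) ⟩
    w (s + (t + x))   ≡⟨ cong w (+-assoc s t x) ⟨
    w (s + t + x)     ≡⟨ eq x≤p ⟩
    w (s + r + x)     ∎
    where
    open ≡-Reasoning
    s+[t+x]<s+L : s + (t + x) < s + L
    s+[t+x]<s+L = ≤-<-trans (+-monoʳ-≤ s (+-mono-≤ t≤r (≤-pred x≤p)))
                            (subst (_< s + L) (+-assoc s r p) b+p<s+L)

  descend : ∀ t → Acc _<_ t → t ≤ r → ¬ Agree w (s + t) (s + r) (suc p)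
  descend t (acc rec) t≤r eq with s′ + t ≤? s
  ... | yes s′+t≤s = new (s′ + t) (≤-trans (+-monoˡ-≤ (suc p) s′+t≤s) s+p<b) (shift t≤r eq)
  ... | no  s′+t≰s with t′ , s+t′≡s′+t ← m≤n⇒∃[o]m+o≡n (<⇒≤ (≰⇒> s′+t≰s)) =
    descend t′ (rec t′<t) (≤-trans (<⇒≤ t′<t) t≤r)
      (subst (λ a → Agree w a (s + r) (suc p)) (sym s+t′≡s′+t) (shift t≤r eq))
    where
    t′<t : t′ < t
    t′<t = +-cancelˡ-< s _ _ (subst (_< s + t) (sym s+t′≡s′+t) (+-monoˡ-< t s′<s))

-- A window without the last position of a factor lies in the copied part of one, hence
-- occurs further to the left; iterate.
anchor : ∀ {w : ℕ → B} {n fs L} → 0 < L → All (Copied w) fs →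
         (∀ g → g < n → Any (Covers g) fs) →
         ∀ g → Acc _<_ g → g < n →
         ∃[ g′ ] ∃[ j ] ∃[ o ] Agree w g′ g L × g′ + toℕ {L} o ≡ uncurry _+_ (lookup fs j)
anchor {w = w} {fs = fs} {L} 0<L copied cover g (acc rec) g<n
  with c ← cover g g<n
  with b , p ← Any.lookup c in eq | (q , q+p≤b , agree) , (b≤g , g≤b+p) ← All.lookupAny copied c
  with g + L ≤? b + p
... | no  g+L≰b+p with o , g+o≡b+p ← m≤n⇒∃[o]m+o≡n g≤b+p =
  g , Any.index c , fromℕ< o<L , (λ _ → refl) ,
  trans (cong (λ i → g + i) (Fin.toℕ-fromℕ< o<L)) (trans g+o≡b+p (sym (cong (uncurry _+_) eq)))
  where
  o<L : o < L
  o<L = +-cancelˡ-< g _ _ (subst (_< g + L) (sym g+o≡b+p) (≰⇒> g+L≰b+p))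
... | yes g+L≤b+p with y , refl ← m≤n⇒∃[o]m+o≡n b≤g =
  let g′ , j , o , agree′ , g′+o≡last =
        anchor {w = w} 0<L copied cover (q + y) (rec q+y<b+y) (<-trans q+y<b+y g<n)
  in g′ , j , o , (λ x<L → trans (agree′ x<L) (copy x<L)) , g′+o≡last
  where
  y+L≤p : y + L ≤ p
  y+L≤p = +-cancelˡ-≤ b _ _ (subst (_≤ b + p) (+-assoc b y L) g+L≤b+p)
  q+y<b+y : q + y < b + y
  q+y<b+y = +-monoˡ-< y (<-≤-trans (m<m+n q (<-≤-trans 0<L (m+n≤o⇒n≤o y y+L≤p))) q+p≤b)
  copy : Agree w (q + y) (b + y) L
  copy {x} x<L = trans (cong w (+-assoc q y x))
    (trans (agree (<-≤-trans (+-monoʳ-< y x<L) y+L≤p)) (cong w (sym (+-assoc b y x))))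

-- Counting the factors of the suffix at one scale.

HasScale : ℕ → ℕ × ℕ → Set
HasScale D (b , p) = D ≤ suc p × suc p < 2 * D

module _ (w : ℕ → B) {n : ℕ} {fs : List (ℕ × ℕ)} (copied : All (Copied w) fs)
         (cover : ∀ g → g < n → Any (Covers g) fs) (i : ℕ) where

  private
    v : ℕ → B
    v x = w (i + x)

    -- The bound `i + b < n` keeps windows that start at or before `b` in the range of `cover`, as
    -- `anchor` requires.
    Factor : ℕ × ℕ → Set
    Factor (b , p) = New v (b , p) × i + b < n

  -- `anchor` encodes each window by a factor and an offset, and this pair determines the content of
  -- the window. Fresh windows at different positions have different contents, so the code is
  -- injective.
  fresh-count : ∀ {m L} → 0 < L → (f : Fin m → ℕ) → (∀ a → i + f a < n) →
                (∀ a → Fresh v L (f a)) → (∀ {a a′} → f a ≡ f a′ → a ≡ a′) →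
                m ≤ length fs * L
  fresh-count {m} {L} 0<L f f<n fresh f-injective = Fin.injective⇒≤ code-injective
    where
    anchored = λ a → anchor {w = w} 0<L copied cover (i + f a) (<-wellFounded _) (f<n a)

    code : Fin m → Fin (length fs * L)
    code a = let _ , j , o , _ = anchored a in combine j o

    same-window : ∀ {a a′} → code a ≡ code a′ → Agree v (f a) (f a′) L
    same-window {a} {a′} eq {x} x<L
      with g , j , o , agree , g+o ← anchored a
         | g′ , j′ , o′ , agree′ , g′+o′ ← anchored a′
      with refl , refl ← Fin.combine-injective j o j′ o′ eq
      -- Both anchored copies hold the last position of the same factor at the same offset, so they
      -- start at the same place.
      with refl ← +-cancelʳ-≡ (toℕ o) g g′ (trans g+o (sym g′+o′)) = begin
        w (i + (f a + x))   ≡⟨ cong w (+-assoc i (f a) x) ⟨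
        w (i + f a + x)     ≡⟨ agree x<L ⟨
        w (g + x)           ≡⟨ agree′ x<L ⟩
        w (i + f a′ + x)    ≡⟨ cong w (+-assoc i (f a′) x) ⟩
        w (i + (f a′ + x))  ∎
      where open ≡-Reasoning

    code-injective : ∀ {a a′} → code a ≡ code a′ → a ≡ a′
    code-injective {a} {a′} eq with <-cmp (f a) (f a′)
    -- Of two equal windows, the later one is not fresh.
    ... | tri< fa<fa′ _ _ = ⊥-elim (fresh a′ fa<fa′ (same-window eq))
    ... | tri≈ _ fa≡fa′ _ = f-injective fa≡fa′
    ... | tri> _ _ fa′<fa = ⊥-elim (fresh a fa′<fa (same-window (sym eq)))

  late-factors : ∀ {D} → 0 < D → ∀ qs → AllPairs Precedes qs → All Factor qs →
                 All (HasScale D) qs → All (λ (b , _) → 5 * D ≤ b) qs →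
                 length qs * D ≤ length fs * (5 * D)
  late-factors {D} 0<D qs disjoint factors scales lates =
    fresh-count (*-mono-≤ (s≤s (z≤n {4})) 0<D) (start ∘ remQuot D)
      (start<n ∘ remQuot D) (start-fresh ∘ remQuot D) start-injective
    where
    at : ∀ {P : ℕ × ℕ → Set} → All P qs → (a : Fin (length qs)) → P (lookup qs a)
    at ps a = All.lookup ps (∈-lookup a)

    -- With factor length `ℓ = suc p`, the window ends `t` positions after the factor does, so it
    -- contains the whole factor. It also starts at least `ℓ` before `b`, because `2 * ℓ + t` is
    -- less than `5 * D`. This is where the length `5 * D` comes from.
    start : Fin (length qs) × Fin D → ℕ
    start (a , t) = let b , p = lookup qs a in (b ∸ 5 * D) + (suc p + toℕ t)

    before : ∀ a t → start (a , t) + suc (proj₂ (lookup qs a)) ≤ proj₁ (lookup qs a)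
    before a t with b , p ← lookup qs a | D≤p , p<2D ← at scales a | 5D≤b ← at lates a = begin
      b ∸ 5 * D + (suc p + toℕ t) + suc p    ≡⟨ +-assoc (b ∸ 5 * D) _ _ ⟩
      b ∸ 5 * D + (suc p + toℕ t + suc p)    ≤⟨ +-monoʳ-≤ (b ∸ 5 * D) p+t+p≤ ⟩
      b ∸ 5 * D + (2 * D + D + 2 * D)        ≡⟨ cong (λ m → b ∸ 5 * D + m) (2D+D+2D D) ⟩
      b ∸ 5 * D + 5 * D                      ≡⟨ m∸n+n≡m 5D≤b ⟩
      b                                      ∎
      where
      open ≤-Reasoning
      p+t+p≤ : suc p + toℕ t + suc p ≤ 2 * D + D + 2 * D
      p+t+p≤ = +-mono-≤ (+-mono-≤ (<⇒≤ p<2D) (<⇒≤ (Fin.toℕ<n t))) (<⇒≤ p<2D)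
      2D+D+2D : ∀ D → 2 * D + D + 2 * D ≡ 5 * D
      2D+D+2D = solve-∀

    after : ∀ a t → uncurry _+_ (lookup qs a) < start (a , t) + 5 * D
    after a t with b , p ← lookup qs a | 5D≤b ← at lates a = begin-strict
      b + p                                  <⟨ +-monoʳ-< b (s≤s (m≤m+n p (toℕ t))) ⟩
      b + (suc p + toℕ t)                    ≡⟨ cong (_+ (suc p + toℕ t)) (m∸n+n≡m 5D≤b) ⟨
      b ∸ 5 * D + 5 * D + (suc p + toℕ t)    ≡⟨ swap (b ∸ 5 * D) (5 * D) (suc p + toℕ t) ⟩
      b ∸ 5 * D + (suc p + toℕ t) + 5 * D    ∎
      where
      open ≤-Reasoning
      swap : ∀ x y z → x + y + z ≡ x + z + y
      swap = solve-∀

    start<n : ∀ x → i + start x < n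
    start<n (a , t) =
      ≤-<-trans (+-monoʳ-≤ i (m+n≤o⇒m≤o _ (before a t))) (proj₂ (at factors a))

    start-fresh : ∀ x → Fresh v (5 * D) (start x)
    start-fresh (a , t) =
      new⇒fresh {w = v} (proj₁ (at factors a)) (before a t) (after a t)

    -- Starts are measured from the ends of the factors. A later factor has length at least `D`, so
    -- its end lies at least `D` further right, and this exceeds any `t < D`.
    start-mono : ∀ {a a′} → a Fin.< a′ → ∀ t t′ → start (a , t) < start (a′ , t′)
    start-mono {a} {a′} a<a′ t t′
      with b , p ← lookup qs a | b′ , p′ ← lookup qs a′
         | b+p<b′ ← AllPairs-lookup disjoint a<a′
         | 5D≤b ← at lates a | D≤p′ , _ ← at scales a′ = begin-strict
      b ∸ 5 * D + (suc p + toℕ t)       <⟨ +-monoʳ-< (b ∸ 5 * D) (+-monoʳ-< (suc p) (Fin.toℕ<n t)) ⟩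
      b ∸ 5 * D + (suc p + D)           ≡⟨ +-assoc (b ∸ 5 * D) (suc p) D ⟨
      b ∸ 5 * D + suc p + D             ≡⟨ cong (_+ D) (+-∸-comm (suc p) 5D≤b) ⟨
      b + suc p ∸ 5 * D + D             ≤⟨ +-mono-≤ (∸-monoˡ-≤ (5 * D) b+suc[p]≤b′) (≤-trans D≤p′ (m≤m+n _ _)) ⟩
      b′ ∸ 5 * D + (suc p′ + toℕ t′)    ∎
      where
      open ≤-Reasoning
      b+suc[p]≤b′ : b + suc p ≤ b′
      b+suc[p]≤b′ = subst (_≤ b′) (sym (+-suc b p)) b+p<b′

    start-injective : ∀ {k k′} → start (remQuot D k) ≡ start (remQuot D k′) → k ≡ k′
    start-injective {k} {k′} eq = begin
      k                        ≡⟨ Fin.combine-remQuot {length qs} D k ⟨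
      uncurry combine (rq k)   ≡⟨ cong (uncurry combine) (pair-injective (rq k) (rq k′) eq) ⟩
      uncurry combine (rq k′)  ≡⟨ Fin.combine-remQuot {length qs} D k′ ⟩
      k′                       ∎
      where
      open ≡-Reasoning
      rq = remQuot {length qs} D
      pair-injective : ∀ x y → start x ≡ start y → x ≡ y
      pair-injective (a , t) (a′ , t′) eq with Fin.<-cmp a a′
      ... | tri< a<a′ _ _ = contradiction eq (<⇒≢ (start-mono a<a′ t t′))
      ... | tri> _ _ a′<a = contradiction (sym eq) (<⇒≢ (start-mono a′<a t′ t))
      ... | tri≈ _ refl _ = cong (a ,_) (Fin.toℕ-injective
        (+-cancelˡ-≡ (suc (proj₂ (lookup qs a))) _ _
          (+-cancelˡ-≡ (proj₁ (lookup qs a) ∸ 5 * D) _ _ eq)))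

  -- Five disjoint factors of length at least `D` occupy `5 * D` positions, so every factor after
  -- the first five is late enough for `late-factors`. The common factor `D` then cancels.
  scale-count : ∀ {D} .{{_ : NonZero D}} qs → AllPairs Precedes qs → All Factor qs →
                All (HasScale D) qs → length qs ≤ 5 + length fs * 5
  scale-count [] _ _ _ = z≤n
  scale-count (_ ∷ []) _ _ _ = m≤m+n 1 _
  scale-count (_ ∷ _ ∷ []) _ _ _ = m≤m+n 2 _
  scale-count (_ ∷ _ ∷ _ ∷ []) _ _ _ = m≤m+n 3 _
  scale-count (_ ∷ _ ∷ _ ∷ _ ∷ []) _ _ _ = m≤m+n 4 _
  scale-count {D} ((b₁ , p₁) ∷ (b₂ , p₂) ∷ (b₃ , p₃) ∷ (b₄ , p₄) ∷ (b₅ , p₅) ∷ qs)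
    ((≤b₂ ∷ _) ∷ (≤b₃ ∷ _) ∷ (≤b₄ ∷ _) ∷ (≤b₅ ∷ _) ∷ ≤b ∷ disjoint)
    (_ ∷ _ ∷ _ ∷ _ ∷ _ ∷ factors)
    ((≤p₁ , _) ∷ (≤p₂ , _) ∷ (≤p₃ , _) ∷ (≤p₄ , _) ∷ (≤p₅ , _) ∷ scales) =
    +-monoʳ-≤ 5 (*-cancelʳ-≤ (length qs) (length fs * 5) D
      (subst (length qs * D ≤_) (sym (*-assoc (length fs) 5 D))
      (late-factors (>-nonZero⁻¹ D) qs disjoint factors scales (All.map (λ {f} → late {f}) ≤b))))
    where
    next : ∀ {k b p b′} → k * D ≤ b → D ≤ suc p → suc (b + p) ≤ b′ → suc k * D ≤ b′
    next {k} {b} {p} kD≤b D≤p b+p<b′ = begin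
      D + k * D    ≤⟨ +-mono-≤ D≤p kD≤b ⟩
      suc p + b    ≡⟨ cong suc (+-comm p b) ⟩
      suc (b + p)  ≤⟨ b+p<b′ ⟩
      _            ∎
      where open ≤-Reasoning
    late : ∀ {f} → suc (b₅ + p₅) ≤ proj₁ f → 5 * D ≤ proj₁ f
    late = next {4} (next {3} (next {2} (next {1} (next {0} z≤n ≤p₁ ≤b₂) ≤p₂ ≤b₃) ≤p₃ ≤b₄) ≤p₄ ≤b₅) ≤p₅

-- The greedy factorization as a list of intervals.

infixl 9 _!_

_!_ : List X → ℕ → Maybe X
[]       ! _     = nothing
(x ∷ xs) ! zero  = just x
(x ∷ xs) ! suc i = xs ! i

!-drop : ∀ b (xs : List X) x → drop b xs ! x ≡ xs ! (b + x)
!-drop zero    xs       x = refl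
!-drop (suc b) []       x = refl
!-drop (suc b) (_ ∷ xs) x = !-drop b xs x

!-take : ∀ {m x} (xs : List X) → x < m → take m xs ! x ≡ xs ! x
!-take             []       (s≤s _)   = refl
!-take {x = zero}  (_ ∷ xs) (s≤s _)   = refl
!-take {x = suc x} (_ ∷ xs) (s≤s x<m) = !-take xs x<m

[suc_⋯]-drop : ∀ b (S : List X) → S [ suc b ⋯] ≡ drop b S
[suc b ⋯]-drop S = take-all (length S ∸ b) (drop b S) (≤-reflexive (length-drop b S))

module _ {A : Set} (_≟_ : DecidableEquality A) where
  open LZ _≟_

  lcp-agree : ∀ xs ys {x} → x < lcp xs ys → xs ! x ≡ ys ! x
  lcp-agree (a ∷ xs) (b ∷ ys) {x} x<lcp with a ≟ b
  lcp-agree (a ∷ xs) (b ∷ ys) {zero}  _           | yes a≡b = cong just a≡b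
  lcp-agree (a ∷ xs) (b ∷ ys) {suc x} (s≤s x<lcp) | yes _   = lcp-agree xs ys x<lcp

  lcp≤length : ∀ xs ys → lcp xs ys ≤ length ys
  lcp≤length []       _        = z≤n
  lcp≤length (_ ∷ _)  []       = z≤n
  lcp≤length (a ∷ xs) (b ∷ ys) with a ≟ b
  ... | yes _ = s≤s (lcp≤length xs ys)
  ... | no  _ = z≤n

  -- The bound on `m` excludes spurious agreement of `nothing` with `nothing` past both ends.
  lcp-max : ∀ xs ys {m} → m ≤ length ys → (∀ {x} → x < m → xs ! x ≡ ys ! x) → m ≤ lcp xs ys
  lcp-max xs       ys       {zero}  _         _  = z≤n
  lcp-max []       (b ∷ ys) {suc m} _         eq = contradiction (eq (s≤s z≤n)) λ ()
  lcp-max (a ∷ xs) (b ∷ ys) {suc m} (s≤s m≤) eq with a ≟ b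
  ... | yes _   = s≤s (lcp-max xs ys m≤ (λ x<m → eq (s≤s x<m)))
  ... | no  a≢b = contradiction (just-injective (eq (s≤s z≤n))) a≢b

  -- Definitionally `S [ suc q ⋯ b ]`, the candidate for `j = suc q` in `p S (suc b)`.
  source : List A → ℕ → ℕ → List A
  source S b q = take (b ∸ q) (drop q S)

  !-source : ∀ S {b q x} → x < b ∸ q → source S b q ! x ≡ S ! (q + x)
  !-source S {b} {q} x<b∸q = trans (!-take (drop q S) x<b∸q) (!-drop q S _)

  length-source : ∀ S {b q} → b ≤ length S → length (source S b q) ≡ b ∸ q
  length-source S {b} {q} b≤∣S∣ = trans (length-take (b ∸ q) (drop q S))
    (m≤n⇒m⊓n≡m (subst (b ∸ q ≤_) (sym (length-drop q S)) (∸-monoˡ-≤ q b≤∣S∣)))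

  !-target : ∀ S b x → S [ suc b ⋯] ! x ≡ S ! (b + x)
  !-target S b x = trans (cong (λ (xs : List A) → xs ! x) ([suc b ⋯]-drop S)) (!-drop b S x)

  -- The maximum is either its default 0, copied vacuously from position 0, or one of the
  -- candidates, each of which is copied from its own `q`.
  p-copied : ∀ S {b} → b < length S → Copied (S !_) (b , p S (suc b))
  p-copied S {b} b<∣S∣ = Extrema.argmax-all id {P = λ m → Copied (S !_) (b , m)} (0 , z≤n , λ ())
    (All.map⁺ (All.map⁺ (All.map (λ {q} → copied q) (All.all-upTo b))))
    where
    copied : ∀ q → q < b → Copied (S !_) (b , lcp (S [ suc b ⋯]) (source S b q))
    copied q q<b = q , q+l≤b , agree
      where
      l : ℕ
      l = lcp (S [ suc b ⋯]) (source S b q)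
      l≤b∸q : l ≤ b ∸ q
      l≤b∸q = subst (l ≤_) (length-source S {b} {q} (<⇒≤ b<∣S∣)) (lcp≤length (S [ suc b ⋯]) (source S b q))
      q+l≤b : q + l ≤ b
      q+l≤b = subst (q + l ≤_) (m+[n∸m]≡n (<⇒≤ q<b)) (+-monoʳ-≤ q l≤b∸q)
      agree : Agree (S !_) q b l
      agree {x} x<l = begin
        S ! (q + x)       ≡⟨ !-source S {b} {q} (<-≤-trans x<l l≤b∸q) ⟨
        source S b q ! x  ≡⟨ lcp-agree (S [ suc b ⋯]) (source S b q) x<l ⟨
        S [ suc b ⋯] ! x  ≡⟨ !-target S b x ⟩
        S ! (b + x)       ∎
        where open ≡-Reasoning

  -- An earlier occurrence of the whole factor would give a candidate exceeding the maximum. If the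
  -- factor runs past the end of `S`, its final `nothing` matches no letter of the source.
  p-new : ∀ S {b} → b < length S → New (S !_) (b , p S (suc b))
  p-new S {b} b<∣S∣ q q+p<b agree = <-irrefl refl (≤-trans p<lcp lcp≤p)
    where
    p<b∸q : suc (p S (suc b)) ≤ b ∸ q
    p<b∸q = m+n≤o⇒m≤o∸n _ (subst (_≤ b) (+-comm q _) q+p<b)
    agree′ : ∀ {x} → x < suc (p S (suc b)) → S [ suc b ⋯] ! x ≡ source S b q ! x
    agree′ {x} x≤p = begin
      S [ suc b ⋯] ! x  ≡⟨ !-target S b x ⟩
      S ! (b + x)       ≡⟨ agree x≤p ⟨
      S ! (q + x)       ≡⟨ !-source S {b} {q} (<-≤-trans x≤p p<b∸q) ⟨
      source S b q ! x  ∎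
      where open ≡-Reasoning
    p<lcp : suc (p S (suc b)) ≤ lcp (S [ suc b ⋯]) (source S b q)
    p<lcp = lcp-max (S [ suc b ⋯]) (source S b q)
      (subst (suc (p S (suc b)) ≤_) (sym (length-source S {b} {q} (<⇒≤ b<∣S∣))) p<b∸q) agree′
    q<b : q < b
    q<b = <-≤-trans (m<m+n q (s≤s z≤n)) q+p<b
    lcp≤p : lcp (S [ suc b ⋯]) (source S b q) ≤ p S (suc b)
    lcp≤p = All.lookup (Extrema.xs≤max 0 _)
      (∈-map⁺ (λ j → lcp (S [ suc b ⋯]) (S [ j ⋯ b ])) (∈-map⁺ suc (∈-upTo⁺ q<b)))

  -- Follows the recursion of `factorsFrom`, but 0-based and without cutting the last factor at the
  -- end of `S`.
  factorsAt : ℕ → List A → ℕ → List (ℕ × ℕ)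
  factorsAt zero    S b = []
  factorsAt (suc k) S b with b <? length S
  ... | yes _ = (b , p S (suc b)) ∷ factorsAt k S (suc (b + p S (suc b)))
  ... | no  _ = []

  length-factorsFrom : ∀ k S b → length (factorsFrom k S (suc b)) ≡ length (factorsAt k S b)
  length-factorsFrom zero    S b = refl
  length-factorsFrom (suc k) S b with b <? length S
  -- The test `suc b ≤ᵇ length S` of `factorsFrom` reduces to `b <ᵇ length S`.
  ... | yes b<∣S∣ rewrite Equivalence.to T-≡ (<⇒<ᵇ b<∣S∣) = cong suc (length-factorsFrom k S _)
  ... | no  b≮∣S∣ with b <ᵇ length S in eq
  ...   | true  = contradiction (<ᵇ⇒< b (length S) (subst T (sym eq) tt)) b≮∣S∣
  ...   | false = refl

  factorsAt-all : ∀ {P : ℕ × ℕ → Set} S → (∀ {b} → b < length S → P (b , p S (suc b))) →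
                  ∀ k b → All P (factorsAt k S b)
  factorsAt-all S f zero    b = []
  factorsAt-all S f (suc k) b with b <? length S
  ... | yes b<∣S∣ = f b<∣S∣ ∷ factorsAt-all S f k _
  ... | no  _     = []

  factorsAt-from : ∀ k S b → All (λ f → b ≤ proj₁ f) (factorsAt k S b)
  factorsAt-from zero    S b = []
  factorsAt-from (suc k) S b with b <? length S
  ... | yes _ = ≤-refl ∷ All.map (≤-trans (m≤n⇒m≤1+n (m≤m+n b _))) (factorsAt-from k S _)
  ... | no  _ = []

  factorsAt-disjoint : ∀ k S b → AllPairs Precedes (factorsAt k S b)
  factorsAt-disjoint zero    S b = []
  factorsAt-disjoint (suc k) S b with b <? length S
  ... | yes _ = factorsAt-from k S _ ∷ factorsAt-disjoint k S _
  ... | no  _ = []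

  -- Each factor advances the position by at least one, so the fuel bound `length S ≤ k + b`
  -- persists along the recursion.
  factorsAt-cover : ∀ k S b → length S ≤ k + b → ∀ g → b ≤ g → g < length S →
                    Any (Covers g) (factorsAt k S b)
  factorsAt-cover zero    S b ∣S∣≤b g b≤g g<∣S∣ = contradiction (≤-trans ∣S∣≤b b≤g) (<⇒≱ g<∣S∣)
  factorsAt-cover (suc k) S b ∣S∣≤k+b g b≤g g<∣S∣ with b <? length S
  ... | no  b≮∣S∣ = contradiction (≤-<-trans b≤g g<∣S∣) b≮∣S∣
  ... | yes _ with g ≤? b + p S (suc b)
  ...   | yes g≤b+p = here (b≤g , g≤b+p)
  ...   | no  g≰b+p = there (factorsAt-cover k S _ ∣S∣≤k+b′ g (≰⇒> g≰b+p) g<∣S∣)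
    where
    ∣S∣≤k+b′ : length S ≤ k + suc (b + p S (suc b))
    ∣S∣≤k+b′ = ≤-trans ∣S∣≤k+b
      (subst (_≤ k + suc (b + p S (suc b))) (+-suc k b) (+-monoʳ-≤ k (s≤s (m≤m+n b _))))

  -- Sums `scale-count` over the scales `2 ^ k` with `k < K`.
  zn-suffix : ∀ S i K → i < length S → length S < 2 ^ K →
              zn (S [ suc i ⋯]) ≤ K * (5 + zn S * 5)
  zn-suffix S i K i<n n<2^K = begin
    zn T′                        ≡⟨ length-factorsFrom (length T′) T′ 0 ⟩
    length qs                    ≤⟨ dyadic-count proj₂ {G = SuffixFactor} scales K qs disjoint factors short ⟩
    K * (5 + length fs * 5)      ≡⟨ cong (λ z → K * (5 + z * 5)) (length-factorsFrom n S 0) ⟨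
    K * (5 + zn S * 5)           ∎
    where
    open ≤-Reasoning
    n : ℕ
    n = length S

    T′ : List A
    T′ = S [ suc i ⋯]

    fs qs : List (ℕ × ℕ)
    fs = factorsAt n S 0
    qs = factorsAt (length T′) T′ 0

    ∣T∣≡n∸i : length T′ ≡ n ∸ i
    ∣T∣≡n∸i = trans (cong length ([suc i ⋯]-drop S)) (length-drop i S)

    ∣T∣≤n : length T′ ≤ n
    ∣T∣≤n = subst (_≤ n) (sym ∣T∣≡n∸i) (m∸n≤m n i)

    copied : All (Copied (S !_)) fs
    copied = factorsAt-all S (p-copied S) n 0

    cover : ∀ g → g < n → Any (Covers g) fs
    cover g = factorsAt-cover n S 0 (m≤m+n n 0) g z≤n

    SuffixFactor : ℕ × ℕ → Set
    SuffixFactor (b , p) = New (λ x → S ! (i + x)) (b , p) × i + b < n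

    scales : ∀ k xs → AllPairs Precedes xs → All SuffixFactor xs → All (HasScale (2 ^ k)) xs →
             length xs ≤ 5 + length fs * 5
    scales k = scale-count (S !_) copied cover i {{m^n≢0 2 k}}

    disjoint : AllPairs Precedes qs
    disjoint = factorsAt-disjoint (length T′) T′ 0

    short : All (λ f → suc (proj₂ f) < 2 ^ K) qs
    short = factorsAt-all T′ short′ (length T′) 0
      where
      short′ : ∀ {b} → b < length T′ → suc (p T′ (suc b)) < 2 ^ K
      -- The copied part fits before `b`, hence `suc p ≤ suc b ≤ length T′`.
      short′ {b} b<∣T∣ with q , q+p≤b , _ ← p-copied T′ b<∣T∣ =
        ≤-<-trans (≤-trans (s≤s (m+n≤o⇒n≤o q q+p≤b)) (≤-trans b<∣T∣ ∣T∣≤n)) n<2^K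

    factors : All SuffixFactor qs
    factors = factorsAt-all T′ (λ b<∣T∣ → new b<∣T∣ , inside b<∣T∣) (length T′) 0
      where
      inside : ∀ {b} → b < length T′ → i + b < n
      inside {b} b<∣T∣ = subst (i + b <_) (m+[n∸m]≡n (<⇒≤ i<n))
        (+-monoʳ-< i (subst (b <_) ∣T∣≡n∸i b<∣T∣))
      new : ∀ {b} → b < length T′ → New (λ x → S ! (i + x)) (b , p T′ (suc b))
      new {b} b<∣T∣ q q+p<b agree = p-new T′ b<∣T∣ q q+p<b λ {x} x≤p →
        trans (!-target S i (q + x)) (trans (agree x≤p) (sym (!-target S i (b + x))))

-- From the count of factors to the bound on the ratio.

1≤⌊log₂n⌋ : ∀ {n} → 2 ≤ n → 1 ≤ ⌊log₂ n ⌋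
1≤⌊log₂n⌋ {n} 2≤n = subst (_≤ ⌊log₂ n ⌋) (⌊log₂[2^n]⌋≡n 1) (⌊log₂⌋-mono-≤ 2≤n)

absorb-constants : ∀ {K z} → 1 ≤ K → 1 ≤ z → suc K * (5 + z * 5) ≤ 20 * K * z
absorb-constants {K} {z} 1≤K 1≤z = begin
  -- The constant 20 is 2 times 10: `suc K ≤ 2 * K` and `5 + z * 5 ≤ 10 * z`.
  suc K * (5 + z * 5)  ≤⟨ *-mono-≤ (+-mono-≤ 1≤K (≤-reflexive (sym (+-identityʳ K)))) 5+5z≤10z ⟩
  2 * K * (10 * z)     ≡⟨ [m*n]*[o*p]≡[m*o]*[n*p] 2 K 10 z ⟩
  20 * (K * z)         ≡⟨ *-assoc 20 K z ⟨
  20 * K * z           ∎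
  where
  open ≤-Reasoning
  5+5z≤10z : 5 + z * 5 ≤ 10 * z
  5+5z≤10z = begin
    5 + z * 5      ≡⟨ cong (λ m → 5 + m) (*-comm z 5) ⟩
    5 * 1 + 5 * z  ≤⟨ +-monoˡ-≤ (5 * z) (*-monoʳ-≤ 5 1≤z) ⟩
    5 * z + 5 * z  ≡⟨ *-distribʳ-+ z 5 5 ⟨
    10 * z         ∎

ratio-bound : ∀ {A : Set} (_≟_ : DecidableEquality A) {n r} → 2 ≤ n → LZ.Ratios _≟_ n r →
              r ℚ.≤ (+ (20 * ⌊log₂ n ⌋)) ℚ./ 1
ratio-bound _≟_ 2≤n (S , refl , suc i , _ , i<n , refl) =
  /-≤ (zn (S [ suc i ⋯])) (20 * K) (zn S) {{zn-nonZero S 1≤n}}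
    -- With `K` the rounded-down logarithm, `length S < 2 ^ suc K`, so `suc K` scales suffice.
    (≤-trans (zn-suffix _≟_ S i (suc K) i<n (n<2^[1+⌊log₂n⌋] (length S)))
             (absorb-constants (1≤⌊log₂n⌋ 2≤n) (>-nonZero⁻¹ (zn S) {{zn-nonZero S 1≤n}})))
  where
  open LZ _≟_
  K : ℕ
  K = ⌊log₂ length S ⌋
  1≤n : 1 ≤ length S
  1≤n = <⇒≤ 2≤n

lemma6 : ∃[ C ] ∃[ N ] ((A : Set) (_≟_ : DecidableEquality A) (ζ : ℕ → ℚ) → IsZeta _≟_ ζ →
    (n : ℕ) → 2 ≤ n → N ≤ n → ζ n ℚ.≤ (+ (C * ⌊log₂ n ⌋)) ℚ./ 1)
-- The maximum is attained, so `ζ n` is itself a ratio and `ratio-bound` applies to it.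
lemma6 = 20 , 0 , λ A _≟_ ζ isZeta n 2≤n _ → ratio-bound _≟_ 2≤n (proj₁ (isZeta n 2≤n))
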